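{- Let $\mathcal{C}$ be a category with finite products and weak equalisers in which every object is a choice object. If $\mathcal{C}$ is closed for pseudo-relations, then its exact completion $\mathcal{C}_{ex}$ is locally cartesian closed.
   Context: A weak limit is defined like a limit but without requiring uniqueness of the mediating arrow. Global elements: an arrow $x\colon 1\to X$ from the terminal object is written $x\in X$. For $f\colon X\to Y$ and $y\in Y$ write $y\in_f$ (i.e. "$y$ is in the image of $f$") if there is $x\in X$ with $fx=y$. An arrow $f\colon X\to Y$ is surjective if $y\in_f$ for every $y\in Y$. An object $Y$ is a choice object if every surjection with codomain $Y$ has a section. An arbitrary (not necessarily monic) arrow into a product is called a pseudo-relation. Families of pseudo-relations: given arrows $g\colon Y\to X$ and $f\colon X\to I$, a family of pseudo-relations over $f,g$ is a pair of arrows $h\colon J\to I$, $r\colon R\to J\times X\times Y$ such that (a) for all $j\in J,x\in X,y\in Y$: $\langle j,x,y\rangle\in_r$ implies $gy=x$; (b) for all $j\in J,x\in X$: $fx=hj$ iff there is $y\in Y$ with $\langle j,x,y\rangle\in_r$. A pseudo-relation over $f,g$ with domain index $i\in I$ is an arrow $r\colon R\to X\times Y$ such that for all $x\in X,y\in Y$: $\langle x,y\rangle\in_r$ implies $gy=x$, and $fx=i$ iff there is $y\in Y$ with $\langle x,y\rangle\in_r$. A full family of pseudo-relations over $f,g$ is a family of pseudo-relations $\phi\colon F\to I$, $\alpha\colon P\to F\times X\times Y$ over $f,g$ such that for every pseudo-relation $r\colon R\to X\times Y$ over $f,g$ with domain index $i\in I$ there is $c\in F$ with $\phi c=i$ and,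 for all $x\in X,y\in Y$, $\langle c,x,y\rangle\in_\alpha$ implies $\langle x,y\rangle\in_r$. The category is closed for pseudo-relations if there is a full family of pseudo-relations over every pair of composable arrows $Y\xrightarrow{g}X\xrightarrow{f}I$. Exact completion: a pseudo-equivalence relation on $X$ in $\mathcal{C}$ is an arrow $r=\langle r_1,r_2\rangle\colon R\to X\times X$ for which there exist (not necessarily unique) arrows $\rho\colon X\to R$ with $r\rho=\langle 1_X,1_X\rangle$, $\sigma\colon R\to R$ with $r\sigma=\langle r_2,r_1\rangle$, and $\tau\colon Q\to R$ with $r\tau=\langle r_1p_1,r_2p_2\rangle$, where $(Q,p_1,p_2)$ is a weak pullback of $r_2$ and $r_1$. The category $\mathcal{C}_{ex}$ has as objects the pseudo-equivalence relations of $\mathcal{C}$; an arrow from $r\colon R\to X\times X$ to $s\colon S\to Y\times Y$ is an equivalence class $[f]$ of arrows $f\colon X\to Y$ of $\mathcal{C}$ for which some $\hat f\colon R\to S$ satisfies $s\hat f=(f\times f)r$, where $f,g$ are identified when some $h\colon X\to S$ satisfies $sh=\langle f,g\rangle$; composition is induced by that of $\mathcal{C}$. -}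

module Defs where

open import Level using (Level; _⊔_; suc)
open import Relation.Binary using (Rel; IsEquivalence; Setoid)
open import Data.Product using (Σ; Σ-syntax; _×_; _,_; proj₁; proj₂)
import Relation.Binary.Reasoning.Setoid as SetoidR

record RawCategory (o ℓ e : Level) : Set (suc (o ⊔ ℓ ⊔ e)) where
  infixr 9 _∘_
  infix 4 _≈_ _⇒_
  field
    Obj : Set o
    _⇒_ : Obj → Obj → Set ℓ
    _≈_ : ∀ {A B} → Rel (A ⇒ B) e
    id  : ∀ {A} → A ⇒ A
    _∘_ : ∀ {A B C} → B ⇒ C → A ⇒ B → A ⇒ C

record IsCategory {o ℓ e} (C : RawCategory o ℓ e) : Set (o ⊔ ℓ ⊔ e) where
  open RawCategory C
  field
    equiv     : ∀ {A B} → IsEquivalence (_≈_ {A} {B})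
    assoc     : ∀ {A B C D} {f : A ⇒ B} {g : B ⇒ C} {h : C ⇒ D} →
                (h ∘ g) ∘ f ≈ h ∘ (g ∘ f)
    identityˡ : ∀ {A B} {f : A ⇒ B} → id ∘ f ≈ f
    identityʳ : ∀ {A B} {f : A ⇒ B} → f ∘ id ≈ f
    ∘-resp-≈  : ∀ {A B C} {f h : B ⇒ C} {g i : A ⇒ B} →
                f ≈ h → g ≈ i → f ∘ g ≈ h ∘ i

record Category (o ℓ e : Level) : Set (suc (o ⊔ ℓ ⊔ e)) where
  field
    raw        : RawCategory o ℓ e
    isCategory : IsCategory raw
  open RawCategory raw public
  open IsCategory isCategory public

module _ {o ℓ e} (C : RawCategory o ℓ e) where
  open RawCategory C

  record Terminal : Set (o ⊔ ℓ ⊔ e) where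
    field
      ⊤        : Obj
      !        : ∀ {A} → A ⇒ ⊤
      !-unique : ∀ {A} (f : A ⇒ ⊤) → f ≈ !

  record Product (A B : Obj) : Set (o ⊔ ℓ ⊔ e) where
    field
      A×B      : Obj
      π₁       : A×B ⇒ A
      π₂       : A×B ⇒ B
      ⟨_,_⟩    : ∀ {X} → X ⇒ A → X ⇒ B → X ⇒ A×B
      project₁ : ∀ {X} {f : X ⇒ A} {g : X ⇒ B} → π₁ ∘ ⟨ f , g ⟩ ≈ f
      project₂ : ∀ {X} {f : X ⇒ A} {g : X ⇒ B} → π₂ ∘ ⟨ f , g ⟩ ≈ g
      unique   : ∀ {X} {h : X ⇒ A×B} {f : X ⇒ A} {g : X ⇒ B} →
                 π₁ ∘ h ≈ f → π₂ ∘ h ≈ g → ⟨ f , g ⟩ ≈ h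

  record FiniteProducts : Set (o ⊔ ℓ ⊔ e) where
    field
      terminal : Terminal
      product  : ∀ A B → Product A B

  record WeakEqualiser {A B : Obj} (f g : A ⇒ B) : Set (o ⊔ ℓ ⊔ e) where
    field
      E       : Obj
      arr     : E ⇒ A
      equal   : f ∘ arr ≈ g ∘ arr
      factor  : ∀ {X} (k : X ⇒ A) → f ∘ k ≈ g ∘ k →
                Σ[ u ∈ X ⇒ E ] (arr ∘ u ≈ k)

  HasWeakEqualisers : Set (o ⊔ ℓ ⊔ e)
  HasWeakEqualisers = ∀ {A B} (f g : A ⇒ B) → WeakEqualiser f g

  record IsWeakPullback {X Y Z : Obj} (f : X ⇒ Z) (g : Y ⇒ Z)
           {Q : Obj} (p₁ : Q ⇒ X) (p₂ : Q ⇒ Y) : Set (o ⊔ ℓ ⊔ e) where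
    field
      commute : f ∘ p₁ ≈ g ∘ p₂
      factor  : ∀ {W} (q₁ : W ⇒ X) (q₂ : W ⇒ Y) → f ∘ q₁ ≈ g ∘ q₂ →
                Σ[ u ∈ W ⇒ Q ] ((p₁ ∘ u ≈ q₁) × (p₂ ∘ u ≈ q₂))

  record Pullback {X Y A : Obj} (f : X ⇒ A) (g : Y ⇒ A) : Set (o ⊔ ℓ ⊔ e) where
    field
      P         : Obj
      p₁        : P ⇒ X
      p₂        : P ⇒ Y
      commute   : f ∘ p₁ ≈ g ∘ p₂
      universal : ∀ {W} (q₁ : W ⇒ X) (q₂ : W ⇒ Y) → f ∘ q₁ ≈ g ∘ q₂ →
                  Σ[ m ∈ W ⇒ P ] ((p₁ ∘ m ≈ q₁) × (p₂ ∘ m ≈ q₂))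
      unique    : ∀ {W} (m m′ : W ⇒ P) → p₁ ∘ m ≈ p₁ ∘ m′ → p₂ ∘ m ≈ p₂ ∘ m′ →
                  m ≈ m′

  HasPullbacks : Set (o ⊔ ℓ ⊔ e)
  HasPullbacks = ∀ {X Y A} (f : X ⇒ A) (g : Y ⇒ A) → Pullback f g

  -- Exponential in the slice C/A of (Y,g) and (Z,h).  Binary products in
  -- C/A are the (chosen) pullbacks:  (W,w) ×_A (Y,g) = (P (pb w g), w ∘ p₁),
  -- and arrows of C/A are arrows of C commuting with the structure maps,
  -- with the equality of C.
  module _ (pb : HasPullbacks) where
    open Pullback

    record SliceExponential {A Y Z : Obj} (g : Y ⇒ A) (h : Z ⇒ A)
           : Set (o ⊔ ℓ ⊔ e) where
      field
        E     : Obj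
        e↓    : E ⇒ A
        ev      : P (pb e↓ g) ⇒ Z
        ev-over : h ∘ ev ≈ e↓ ∘ p₁ (pb e↓ g)
        curry      : ∀ {W} (w : W ⇒ A) (u : P (pb w g) ⇒ Z) →
                     h ∘ u ≈ w ∘ p₁ (pb w g) → W ⇒ E
        curry-over : ∀ {W} (w : W ⇒ A) (u : P (pb w g) ⇒ Z)
                     (u-over : h ∘ u ≈ w ∘ p₁ (pb w g)) →
                     e↓ ∘ curry w u u-over ≈ w
        -- β:  ev ∘ (curry u ×_A Y) = u,  where  m = curry u ×_A Y
        β : ∀ {W} (w : W ⇒ A) (u : P (pb w g) ⇒ Z)
            (u-over : h ∘ u ≈ w ∘ p₁ (pb w g))
            (m : P (pb w g) ⇒ P (pb e↓ g)) →
            p₁ (pb e↓ g) ∘ m ≈ curry w u u-over ∘ p₁ (pb w g) →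
            p₂ (pb e↓ g) ∘ m ≈ p₂ (pb w g) →
            ev ∘ m ≈ u
        η : ∀ {W} (w : W ⇒ A) (u : P (pb w g) ⇒ Z)
            (u-over : h ∘ u ≈ w ∘ p₁ (pb w g)) (t : W ⇒ E) →
            e↓ ∘ t ≈ w →
            (∀ (m : P (pb w g) ⇒ P (pb e↓ g)) →
               p₁ (pb e↓ g) ∘ m ≈ t ∘ p₁ (pb w g) →
               p₂ (pb e↓ g) ∘ m ≈ p₂ (pb w g) →
               ev ∘ m ≈ u) →
            t ≈ curry w u u-over

  -- Locally cartesian closed: every slice C/A is cartesian closed.
  -- (Terminal of C/A is id_A; binary products in C/A are pullbacks in C;
  --  exponentials in C/A are SliceExponential.)
  IsLCC : Set (o ⊔ ℓ ⊔ e)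
  IsLCC = Σ[ pb ∈ HasPullbacks ]
          (∀ {A Y Z} (g : Y ⇒ A) (h : Z ⇒ A) → SliceExponential pb g h)

module _ {o ℓ e} {C : RawCategory o ℓ e} (fp : FiniteProducts C) where
  open RawCategory C
  open FiniteProducts fp
  open Terminal terminal
  open Product

  _×ₒ_ : Obj → Obj → Obj
  A ×ₒ B = A×B (product A B)

  ⟪_,_⟫ : ∀ {X A B} → X ⇒ A → X ⇒ B → X ⇒ A ×ₒ B
  ⟪ f , g ⟫ = ⟨_,_⟩ (product _ _) f g

  El : Obj → Set ℓ
  El X = ⊤ ⇒ X

  InImage : ∀ {X Y} (f : X ⇒ Y) → El Y → Set (ℓ ⊔ e)
  InImage {X} f y = Σ[ x ∈ El X ] (f ∘ x ≈ y)

  Surjective : ∀ {X Y} (f : X ⇒ Y) → Set (ℓ ⊔ e)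
  Surjective {Y = Y} f = (y : El Y) → InImage f y

  ChoiceObject : Obj → Set (o ⊔ ℓ ⊔ e)
  ChoiceObject Y = ∀ {X} (f : X ⇒ Y) → Surjective f →
                   Σ[ s ∈ Y ⇒ X ] (f ∘ s ≈ id)

  module _ {I X Y : Obj} (f : X ⇒ I) (g : Y ⇒ X) where

    record IsFamilyPR {J R : Obj} (h : J ⇒ I) (r : R ⇒ J ×ₒ (X ×ₒ Y))
           : Set (ℓ ⊔ e) where
      field
        cond-a : ∀ (j : El J) (x : El X) (y : El Y) →
                 InImage r ⟪ j , ⟪ x , y ⟫ ⟫ → g ∘ y ≈ x
        cond-b⇒ : ∀ (j : El J) (x : El X) → f ∘ x ≈ h ∘ j →
                  Σ[ y ∈ El Y ] InImage r ⟪ j , ⟪ x , y ⟫ ⟫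
        cond-b⇐ : ∀ (j : El J) (x : El X) →
                  Σ[ y ∈ El Y ] InImage r ⟪ j , ⟪ x , y ⟫ ⟫ → f ∘ x ≈ h ∘ j

    record IsPRWithIndex (i : El I) {R : Obj} (r : R ⇒ X ×ₒ Y)
           : Set (ℓ ⊔ e) where
      field
        cond-a  : ∀ (x : El X) (y : El Y) → InImage r ⟪ x , y ⟫ → g ∘ y ≈ x
        cond-b⇒ : ∀ (x : El X) → f ∘ x ≈ i →
                  Σ[ y ∈ El Y ] InImage r ⟪ x , y ⟫
        cond-b⇐ : ∀ (x : El X) →
                  Σ[ y ∈ El Y ] InImage r ⟪ x , y ⟫ → f ∘ x ≈ i

    record FullFamilyPR : Set (o ⊔ ℓ ⊔ e) where
      field
        F        : Obj
        φ        : F ⇒ I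
        P        : Obj
        α        : P ⇒ F ×ₒ (X ×ₒ Y)
        isFamily : IsFamilyPR φ α
        full     : ∀ (i : El I) {R : Obj} (r : R ⇒ X ×ₒ Y) →
                   IsPRWithIndex i r →
                   Σ[ c ∈ El F ] ((φ ∘ c ≈ i) ×
                     (∀ (x : El X) (y : El Y) →
                        InImage α ⟪ c , ⟪ x , y ⟫ ⟫ → InImage r ⟪ x , y ⟫))

  ClosedForPseudoRelations : Set (o ⊔ ℓ ⊔ e)
  ClosedForPseudoRelations =
    ∀ {I X Y : Obj} (g : Y ⇒ X) (f : X ⇒ I) → FullFamilyPR f g

module ExCompletion {o ℓ e} (C : Category o ℓ e)
                    (fp : FiniteProducts (Category.raw C)) where
  open Category C
  open FiniteProducts fp
  open Product

  private
    module Pr {A B} = Product (product A B)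

  _⊗_ : Obj → Obj → Obj
  _⊗_ = _×ₒ_ fp

  ⟨_,_⟩ₓ : ∀ {W A B} → W ⇒ A → W ⇒ B → W ⇒ A ⊗ B
  ⟨_,_⟩ₓ = ⟪_,_⟫ fp

  sq : ∀ {X Y} → X ⇒ Y → X ⊗ X ⇒ Y ⊗ Y
  sq f = ⟨ f ∘ Pr.π₁ , f ∘ Pr.π₂ ⟩ₓ

  record PseudoEquivalenceRelation : Set (o ⊔ ℓ ⊔ e) where
    field
      X  : Obj
      R  : Obj
      r  : R ⇒ X ⊗ X
    r₁ : R ⇒ X
    r₁ = Pr.π₁ ∘ r
    r₂ : R ⇒ X
    r₂ = Pr.π₂ ∘ r
    field
      ρ     : X ⇒ R
      ρ-eq  : r ∘ ρ ≈ ⟨ id , id ⟩ₓ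
      σ     : R ⇒ R
      σ-eq  : r ∘ σ ≈ ⟨ r₂ , r₁ ⟩ₓ
      Q     : Obj
      q₁    : Q ⇒ R
      q₂    : Q ⇒ R
      Q-wpb : IsWeakPullback raw r₂ r₁ q₁ q₂
      τ     : Q ⇒ R
      τ-eq  : r ∘ τ ≈ ⟨ r₁ ∘ q₁ , r₂ ∘ q₂ ⟩ₓ

  open PseudoEquivalenceRelation

  record ExHom (A B : PseudoEquivalenceRelation) : Set (ℓ ⊔ e) where
    field
      f    : X A ⇒ X B
      f̂    : R A ⇒ R B
      f̂-eq : r B ∘ f̂ ≈ sq f ∘ r A
  open ExHom

  ExEq : ∀ {A B} → ExHom A B → ExHom A B → Set (ℓ ⊔ e)
  ExEq {A} {B} u v = Σ[ h ∈ X A ⇒ R B ] (r B ∘ h ≈ ⟨ f u , f v ⟩ₓ)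

  private
    module _ {A B : Obj} where
      open IsEquivalence (equiv {A} {B}) public
        renaming (refl to ≈refl; sym to ≈sym; trans to ≈trans)

    S : ∀ {A B} → Setoid ℓ e
    S {A} {B} = record { Carrier = A ⇒ B ; _≈_ = _≈_ ; isEquivalence = equiv }

    π-∘ : ∀ {W X A B} {a : X ⇒ A} {b : X ⇒ B} {k : W ⇒ X} →
          (Pr.π₁ ∘ (⟨ a , b ⟩ₓ ∘ k) ≈ a ∘ k) × (Pr.π₂ ∘ (⟨ a , b ⟩ₓ ∘ k) ≈ b ∘ k)
    π-∘ = ≈trans (≈sym assoc) (∘-resp-≈ Pr.project₁ ≈refl)
        , ≈trans (≈sym assoc) (∘-resp-≈ Pr.project₂ ≈refl)

    sq-id : ∀ {X} → sq (id {X}) ≈ id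
    sq-id = Pr.unique (≈trans identityʳ (≈sym identityˡ))
                      (≈trans identityʳ (≈sym identityˡ))

    sq-∘ : ∀ {X Y Z} {f : X ⇒ Y} {g : Y ⇒ Z} → sq g ∘ sq f ≈ sq (g ∘ f)
    sq-∘ {X} {Y} {Z} {f} {g} = ≈sym (Pr.unique (lem (proj₁ π-∘) Pr.project₁)
                                       (lem (proj₂ π-∘) Pr.project₂))
      where
        lem : ∀ {p : Z ⊗ Z ⇒ Z} {q₀ : Y ⊗ Y ⇒ Y} {q : X ⊗ X ⇒ X} →
              p ∘ (sq g ∘ sq f) ≈ (g ∘ q₀) ∘ sq f →
              q₀ ∘ sq f ≈ f ∘ q → p ∘ (sq g ∘ sq f) ≈ (g ∘ f) ∘ q
        lem e1 e2 = ≈trans e1 (≈trans assoc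
                                 (≈trans (∘-resp-≈ ≈refl e2) (≈sym assoc)))

  ExId : ∀ {A} → ExHom A A
  ExId {A} = record
    { f = id ; f̂ = id
    ; f̂-eq = ≈trans identityʳ (≈sym (≈trans (∘-resp-≈ sq-id ≈refl) identityˡ)) }

  ExComp : ∀ {A B D} → ExHom B D → ExHom A B → ExHom A D
  ExComp {A} {B} {D} v u = record
    { f = f v ∘ f u
    ; f̂ = f̂ v ∘ f̂ u
    ; f̂-eq = begin
        r D ∘ (f̂ v ∘ f̂ u)         ≈⟨ ≈sym assoc ⟩
        (r D ∘ f̂ v) ∘ f̂ u         ≈⟨ ∘-resp-≈ (f̂-eq v) ≈refl ⟩
        (sq (f v) ∘ r B) ∘ f̂ u    ≈⟨ assoc ⟩
        sq (f v) ∘ (r B ∘ f̂ u)    ≈⟨ ∘-resp-≈ ≈refl (f̂-eq u) ⟩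
        sq (f v) ∘ (sq (f u) ∘ r A) ≈⟨ ≈sym assoc ⟩
        (sq (f v) ∘ sq (f u)) ∘ r A ≈⟨ ∘-resp-≈ sq-∘ ≈refl ⟩
        sq (f v ∘ f u) ∘ r A ∎ }
    where open SetoidR S

  Ex : RawCategory (o ⊔ ℓ ⊔ e) (ℓ ⊔ e) (ℓ ⊔ e)
  Ex = record
    { Obj = PseudoEquivalenceRelation
    ; _⇒_ = ExHom
    ; _≈_ = ExEq
    ; id  = ExId
    ; _∘_ = ExComp }

-- Weak equalisers and choice make the arrows of C behave like functions between
-- sets of global elements: an arrow factors through another as soon as it does
-- so pointwise, and a total internal relation (one of the form y ∈_r) contains
-- an arrow.  An object of the exact completion is thus a set of global elements
-- with an internal equivalence relation, and its arrows and their equality can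
-- be described pointwise.  Full families of pseudo-relations make internal
-- predicates closed under universal quantification along an arbitrary arrow,
-- hence also under implication.
--
-- For the exponential of h by g over A, take the full family over
-- {(a,y,z) : a ~ g y, a ~ h z} → {(a,y) : a ~ g y} → A and restrict its index
-- to those c whose relation between y and z is functional with respect to ~;
-- two indices are equivalent if they lie over equivalent points of A and their
-- relations agree.  Evaluation chooses a value.  For an arrow u out of the
-- fibre product of w and g, the relation z ~ u(v,y) is, for each v, a
-- pseudo-relation with index w v, and currying chooses a member of the family
-- contained in it.
module Submission where

open import Defs
open import Level using (Level; _⊔_)
open import Data.List.Base using (List; []; _∷_)
open import Data.Product using (Σ; Σ-syntax; _×_; _,_; proj₁; proj₂)
open import Data.Unit.Polymorphic.Base using (tt) renaming (⊤ to Unit)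
open import Function.Base using (_$_)
open import Relation.Binary using (IsEquivalence; Setoid)
import Relation.Binary.Reasoning.Setoid as SetoidR

-- Global elements and pairing.

module Points {o ℓ e} (C : Category o ℓ e) (fp : FiniteProducts (Category.raw C)) where
  open Category C
  open FiniteProducts fp
  open Terminal terminal using (⊤; !; !-unique)

  Pt : Obj → Set ℓ
  Pt = El fp

  infixr 7 _⊗_
  _⊗_ : Obj → Obj → Obj
  _⊗_ = _×ₒ_ fp

  open module Pr {A B} = Product (product A B) using (π₁; π₂; project₁; project₂) public
  open Pr using () renaming (⟨_,_⟩ to ⟨_,_⟩ₚ; unique to pair-unique)

  _∈_ : ∀ {X Y} → Pt Y → X ⇒ Y → Set (ℓ ⊔ e)
  y ∈ f = InImage fp f y

  hom-setoid : Obj → Obj → Setoid ℓ e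
  hom-setoid A B = record { Carrier = A ⇒ B ; _≈_ = _≈_ ; isEquivalence = equiv }

  module _ {A B : Obj} where
    open IsEquivalence (equiv {A} {B}) public using ()
      renaming (refl to ≈-refl; sym to ≈-sym; trans to ≈-trans)

  module _ {A B D : Obj} where
    ∘-congˡ : {k : B ⇒ D} {f g : A ⇒ B} → f ≈ g → k ∘ f ≈ k ∘ g
    ∘-congˡ = ∘-resp-≈ ≈-refl

    ∘-congʳ : {f g : B ⇒ D} {k : A ⇒ B} → f ≈ g → f ∘ k ≈ g ∘ k
    ∘-congʳ p = ∘-resp-≈ p ≈-refl

  pair-cong : ∀ {W A B} {f f′ : W ⇒ A} {g g′ : W ⇒ B} →
              f ≈ f′ → g ≈ g′ → ⟨ f , g ⟩ₚ ≈ ⟨ f′ , g′ ⟩ₚ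
  pair-cong p q = pair-unique (≈-trans project₁ (≈-sym p)) (≈-trans project₂ (≈-sym q))

  pair-∘ : ∀ {V W A B} {f : W ⇒ A} {g : W ⇒ B} {k : V ⇒ W} →
           ⟨ f , g ⟩ₚ ∘ k ≈ ⟨ f ∘ k , g ∘ k ⟩ₚ
  pair-∘ = ≈-sym (pair-unique (≈-trans (≈-sym assoc) (∘-congʳ project₁))
                             (≈-trans (≈-sym assoc) (∘-congʳ project₂)))

  pair-injˡ : ∀ {W A B} {f f′ : W ⇒ A} {g g′ : W ⇒ B} →
              ⟨ f , g ⟩ₚ ≈ ⟨ f′ , g′ ⟩ₚ → f ≈ f′
  pair-injˡ p = ≈-trans (≈-sym project₁) (≈-trans (∘-congˡ p) project₁)

  pair-injʳ : ∀ {W A B} {f f′ : W ⇒ A} {g g′ : W ⇒ B} →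
              ⟨ f , g ⟩ₚ ≈ ⟨ f′ , g′ ⟩ₚ → g ≈ g′
  pair-injʳ p = ≈-trans (≈-sym project₂) (≈-trans (∘-congˡ p) project₂)

  pair-η : ∀ {W A B} {h : W ⇒ A ⊗ B} → ⟨ π₁ ∘ h , π₂ ∘ h ⟩ₚ ≈ h
  pair-η = pair-unique ≈-refl ≈-refl

  pt-unique : (x y : Pt ⊤) → x ≈ y
  pt-unique x y = ≈-trans (!-unique x) (≈-sym (!-unique y))

  ∈-resp : ∀ {X Y} {f : X ⇒ Y} {y y′ : Pt Y} → y ≈ y′ → y ∈ f → y′ ∈ f
  ∈-resp p (x , q) = x , ≈-trans q p

-- Pointwise factorisation from weak pullbacks and choice.

module ChoiceCategory {o ℓ e} (C : Category o ℓ e) (fp : FiniteProducts (Category.raw C))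
    (weq : HasWeakEqualisers (Category.raw C))
    (choice : ∀ Y → ChoiceObject fp Y) where
  open Category C
  open FiniteProducts fp
  open Terminal terminal using (⊤; !)
  open Points C fp
  open Pr using () renaming (⟨_,_⟩ to ⟨_,_⟩ₚ)

  record WeakPullback {X Y Z} (f : X ⇒ Z) (g : Y ⇒ Z) : Set (o ⊔ ℓ ⊔ e) where
    field
      W  : Obj
      p  : W ⇒ X
      q  : W ⇒ Y
      isWeakPullback : IsWeakPullback raw f g p q
    open IsWeakPullback isWeakPullback public

  weakPullback : ∀ {X Y Z} (f : X ⇒ Z) (g : Y ⇒ Z) → WeakPullback f g
  weakPullback f g = record
    { W = E ; p = π₁ ∘ arr ; q = π₂ ∘ arr
    ; isWeakPullback = record
      { commute = ≈-trans (≈-sym assoc) (≈-trans equal assoc)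
      ; factor = λ q₁ q₂ eq →
          let u , arr-u = factor ⟨ q₁ , q₂ ⟩ₚ
                (≈-trans assoc (≈-trans (∘-congˡ project₁)
                  (≈-trans eq (≈-sym (≈-trans assoc (∘-congˡ project₂))))))
          in u , ≈-trans assoc (≈-trans (∘-congˡ arr-u) project₁)
               , ≈-trans assoc (≈-trans (∘-congˡ arr-u) project₂) } }
    where open WeakEqualiser (weq (f ∘ π₁) (g ∘ π₂))

  abstract
    -- The projection to `X` of a weak pullback of `k` and `s` is surjective on points by
    -- hypothesis, so choice splits it; the section followed by the other projection is the
    -- factorisation.
    lift : ∀ {X S B} (k : X ⇒ B) (s : S ⇒ B) → (∀ (x : Pt X) → (k ∘ x) ∈ s) →
           Σ[ h ∈ X ⇒ S ] (s ∘ h ≈ k)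
    lift {X} {S} {B} k s k∈s = q ∘ t , (begin
        s ∘ (q ∘ t)  ≈⟨ ≈-sym assoc ⟩
        (s ∘ q) ∘ t  ≈⟨ ∘-congʳ (≈-sym commute) ⟩
        (k ∘ p) ∘ t  ≈⟨ assoc ⟩
        k ∘ (p ∘ t)  ≈⟨ ∘-congˡ p-t ⟩
        k ∘ id       ≈⟨ identityʳ ⟩
        k            ∎)
      where
        open WeakPullback (weakPullback k s)
        open SetoidR (hom-setoid X B)
        split : Σ[ t ∈ X ⇒ W ] (p ∘ t ≈ id)
        split = choice X p λ x →
          let y , sy≈kx = k∈s x
              w , pw≈x , _ = factor x y (≈-sym sy≈kx)
          in w , pw≈x
        t : X ⇒ W
        t = proj₁ split
        p-t : p ∘ t ≈ id
        p-t = proj₂ split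

  -- Internal predicates on tuples of points.

  Env : List Obj → Set ℓ
  Env []      = Unit
  Env (X ∷ Γ) = Pt X × Env Γ

  ⟦_⟧ : List Obj → Obj
  ⟦ [] ⟧    = ⊤
  ⟦ X ∷ Γ ⟧ = X ⊗ ⟦ Γ ⟧

  encode : ∀ Γ → Env Γ → Pt ⟦ Γ ⟧
  encode []      _       = !
  encode (X ∷ Γ) (x , ρ) = ⟨ x , encode Γ ρ ⟩ₚ

  -- Ties an expression `k` in points to an arrow computing it: predicates can then be stated about
  -- points while their images are built from arrows.
  record Term (Γ : List Obj) (X : Obj) (k : Env Γ → Pt X) : Set (ℓ ⊔ e) where
    constructor term
    field
      arr  : ⟦ Γ ⟧ ⇒ X
      spec : ∀ ρ → arr ∘ encode Γ ρ ≈ k ρ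

  var₀ : ∀ {X Γ} → Term (X ∷ Γ) X proj₁
  var₀ = term π₁ λ _ → project₁

  wk : ∀ {X Y Γ k} → Term Γ X k → Term (Y ∷ Γ) X (λ ρ → k (proj₂ ρ))
  wk (term a s) = term (a ∘ π₂) λ (_ , ρ) →
    ≈-trans assoc (≈-trans (∘-congˡ project₂) (s ρ))

  var₁ : ∀ {X₀ X₁ Γ} → Term (X₀ ∷ X₁ ∷ Γ) X₁ (λ ρ → proj₁ (proj₂ ρ))
  var₁ = wk var₀

  var₂ : ∀ {X₀ X₁ X₂ Γ} → Term (X₀ ∷ X₁ ∷ X₂ ∷ Γ) X₂ (λ ρ → proj₁ (proj₂ (proj₂ ρ)))
  var₂ = wk var₁

  const : ∀ {Γ X} (x : Pt X) → Term Γ X (λ _ → x)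
  const x = term (x ∘ !) λ _ →
    ≈-trans assoc (≈-trans (∘-congˡ (pt-unique _ _)) identityʳ)

  infixr 9 _·_
  _·_ : ∀ {Γ X Y k} (f : X ⇒ Y) → Term Γ X k → Term Γ Y (λ ρ → f ∘ k ρ)
  f · term a s = term (f ∘ a) λ ρ → ≈-trans assoc (∘-congˡ (s ρ))

  ⟨_,_⟩ₜ : ∀ {Γ X Y k l} → Term Γ X k → Term Γ Y l →
           Term Γ (X ⊗ Y) (λ ρ → ⟨ k ρ , l ρ ⟩ₚ)
  ⟨ term a s , term b t ⟩ₜ = term ⟨ a , b ⟩ₚ λ ρ →
    ≈-trans pair-∘ (pair-cong (s ρ) (t ρ))

  -- The arrow need not be monic: `P` is just its image on points, which is what weak limits can
  -- provide.
  record Internal (Γ : List Obj) {p} (P : Env Γ → Set p) : Set (o ⊔ ℓ ⊔ e ⊔ p) where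
    field
      dom  : Obj
      arr  : dom ⇒ ⟦ Γ ⟧
      to   : ∀ ρ → P ρ → encode Γ ρ ∈ arr
      from : ∀ ρ → encode Γ ρ ∈ arr → P ρ

  module _ {Γ : List Obj} where
    infixr 4 _∧ᵢ_
    infix  5 _≈ᵢ_ _∈ᵢ_

    mapᵢ : ∀ {p q} {P : Env Γ → Set p} {Q : Env Γ → Set q} →
           (∀ {ρ} → P ρ → Q ρ) → (∀ {ρ} → Q ρ → P ρ) → Internal Γ P → Internal Γ Q
    mapᵢ f g I = record
      { dom = dom ; arr = arr ; to = λ ρ Qρ → to ρ (g Qρ) ; from = λ ρ ρ∈arr → f (from ρ ρ∈arr) }
      where open Internal I

    _≈ᵢ_ : ∀ {X k l} → Term Γ X k → Term Γ X l → Internal Γ (λ ρ → k ρ ≈ l ρ)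
    term a s ≈ᵢ term b t = record
      { dom = E ; arr = arr
      ; to = λ ρ eq → factor (encode Γ ρ) (≈-trans (s ρ) (≈-trans eq (≈-sym (t ρ))))
      ; from = λ ρ (x , eq) → ≈-trans (≈-sym (s ρ)) (≈-trans
          (≈-trans (∘-congˡ (≈-sym eq))
            (≈-trans (≈-sym assoc) (≈-trans (∘-congʳ equal) (≈-trans assoc (∘-congˡ eq)))))
          (t ρ)) }
      where open WeakEqualiser (weq a b)

    _∈ᵢ_ : ∀ {X Y k} → Term Γ Y k → (f : X ⇒ Y) → Internal Γ (λ ρ → k ρ ∈ f)
    term a s ∈ᵢ f = record
      { dom = W ; arr = p
      ; to = λ ρ (x , eq) →
          let w , pw , _ = factor (encode Γ ρ) x (≈-trans (s ρ) (≈-sym eq)) in w , pw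
      ; from = λ ρ (w , eq) → q ∘ w ,
          ≈-trans (≈-sym assoc) (≈-trans (∘-congʳ (≈-sym commute))
            (≈-trans assoc (≈-trans (∘-congˡ eq) (s ρ)))) }
      where open WeakPullback (weakPullback a f)

    _∧ᵢ_ : ∀ {p q} {P : Env Γ → Set p} {Q : Env Γ → Set q} →
           Internal Γ P → Internal Γ Q → Internal Γ (λ ρ → P ρ × Q ρ)
    I ∧ᵢ J = record
      { dom = W ; arr = I.arr ∘ p
      ; to = λ ρ (Pρ , Qρ) →
          let x , px = I.to ρ Pρ
              y , qy = J.to ρ Qρ
              w , pw , _ = factor x y (≈-trans px (≈-sym qy))
          in w , ≈-trans assoc (≈-trans (∘-congˡ pw) px)
      ; from = λ ρ (w , eq) →
          I.from ρ (p ∘ w , ≈-trans (≈-sym assoc) eq) ,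
          J.from ρ (q ∘ w , ≈-trans (≈-sym assoc) (≈-trans (∘-congʳ (≈-sym commute)) eq)) }
      where
        module I = Internal I
        module J = Internal J
        open WeakPullback (weakPullback I.arr J.arr)

  -- Comprehension and choice.

  record Comprehension₂ {X Y p} (P : Pt X → Pt Y → Set p) : Set (o ⊔ ℓ ⊔ e ⊔ p) where
    field
      obj   : Obj
      fst   : obj ⇒ X
      snd   : obj ⇒ Y
      pick  : ∀ {x y} → P x y → Σ[ d ∈ Pt obj ] ((fst ∘ d ≈ x) × (snd ∘ d ≈ y))
      holds : ∀ (d : Pt obj) {x y} → fst ∘ d ≈ x → snd ∘ d ≈ y → P x y

  abstract
    comprehension₂ : ∀ {X Y p} {P : Pt X → Pt Y → Set p} →
      Internal (X ∷ Y ∷ []) (λ (x , y , _) → P x y) → Comprehension₂ P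
    comprehension₂ {X} {Y} {P = P} I = record
      { obj = dom ; fst = π₁ ∘ arr ; snd = π₁ ∘ (π₂ ∘ arr)
      ; pick = λ {x} {y} Pxy →
          let d , eq = to (x , y , tt) Pxy
          in d , ≈-trans assoc (≈-trans (∘-congˡ eq) project₁)
               , ≈-trans assoc (≈-trans (∘-congˡ (≈-trans assoc (∘-congˡ eq)))
                   (≈-trans (∘-congˡ project₂) project₁))
      ; holds = λ d {x} {y} p q → from (x , y , tt)
          -- The context ends in the terminal object, whose points all agree, so the two coordinates
          -- determine the encoded tuple.
          ( d , ≈-sym (Pr.unique (≈-trans (≈-sym assoc) p) (≈-sym (Pr.unique
                  (≈-trans (∘-congˡ (≈-sym assoc)) (≈-trans (≈-sym assoc) q))
                  (pt-unique _ _))))) }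
      where open Internal I

  record Comprehension₁ {X p} (P : Pt X → Set p) : Set (o ⊔ ℓ ⊔ e ⊔ p) where
    field
      obj   : Obj
      emb   : obj ⇒ X
      pick  : ∀ {x} → P x → x ∈ emb
      holds : ∀ (d : Pt obj) {x} → emb ∘ d ≈ x → P x

  abstract
    comprehension₁ : ∀ {X p} {P : Pt X → Set p} →
      Internal (X ∷ []) (λ (x , _) → P x) → Comprehension₁ P
    comprehension₁ {X} {P = P} I = record
      { obj = dom ; emb = π₁ ∘ arr
      ; pick = λ {x} Px →
          let d , eq = to (x , tt) Px in d , ≈-trans assoc (≈-trans (∘-congˡ eq) project₁)
      ; holds = λ d {x} p → from (x , tt)
          (d , ≈-sym (Pr.unique (≈-trans (≈-sym assoc) p) (pt-unique _ _))) }
      where open Internal I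

  abstract
    -- Totality makes the first projection of the comprehension surjective on points; a section of
    -- it picks witnesses for all `x` by one arrow.
    choose : ∀ {X Y p} {T : Pt X → Pt Y → Set p} →
      Internal (X ∷ Y ∷ []) (λ (x , y , _) → T x y) → (∀ x → Σ[ y ∈ Pt Y ] T x y) →
      Σ[ f ∈ X ⇒ Y ] (∀ x → T x (f ∘ x))
    choose {X} {Y} I total = snd ∘ s , λ x →
        holds (s ∘ x) (≈-trans (≈-sym assoc) (≈-trans (∘-congʳ fst-s) identityˡ)) (≈-sym assoc)
      where
        open Comprehension₂ (comprehension₂ I)
        split : Σ[ s ∈ X ⇒ obj ] (fst ∘ s ≈ id)
        split = lift id fst λ x →
          let y , Txy = total x
              d , p , _ = pick Txy
          in d , ≈-trans p (≈-sym identityˡ)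
        s : X ⇒ obj
        s = proj₁ split
        fst-s : fst ∘ s ≈ id
        fst-s = proj₂ split

  -- A pseudo-relation over f, g is determined by a predicate on Y, the index
  -- and the point of X being recovered along g and f.
  module FullFamily {I X Y : Obj} {f : X ⇒ I} {g : Y ⇒ X} (full-family : FullFamilyPR fp f g) where
    open FullFamilyPR full-family public using (F; φ)
    open FullFamilyPR full-family using (α; isFamily; full)
    open IsFamilyPR isFamily

    infix 4 _∋_
    _∋_ : Pt F → Pt Y → Set (ℓ ⊔ e)
    c ∋ y = ⟨ c , ⟨ g ∘ y , y ⟩ₚ ⟩ₚ ∈ α

    infix 5 _∋ᵢ_
    _∋ᵢ_ : ∀ {Γ k l} → Term Γ F k → Term Γ Y l → Internal Γ (λ ρ → k ρ ∋ l ρ)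
    k ∋ᵢ l = ⟨ k , ⟨ g · l , l ⟩ₜ ⟩ₜ ∈ᵢ α

    total : ∀ c x → f ∘ x ≈ φ ∘ c → Σ[ y ∈ Pt Y ] ((c ∋ y) × (g ∘ y ≈ x))
    total c x fx≈φc =
      let y , cxy = cond-b⇒ c x fx≈φc
          gy≈x = cond-a c x y cxy
      in y , ∈-resp (pair-cong ≈-refl (pair-cong (≈-sym gy≈x) ≈-refl)) cxy , gy≈x

    index : ∀ c y → c ∋ y → f ∘ (g ∘ y) ≈ φ ∘ c
    index c y c∋y = cond-b⇐ c (g ∘ y) (y , c∋y)

    -- Fullness in terms of predicates: the points of `U` with their images under `g` form a
    -- pseudo-relation with index `i`. The resulting `c` may hold of fewer points than `U`, but
    -- stays total.
    refine : ∀ {u} {U : Pt Y → Set u} → Internal (Y ∷ []) (λ (y , _) → U y) → ∀ i →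
      (∀ y → U y → f ∘ (g ∘ y) ≈ i) →
      (∀ x → f ∘ x ≈ i → Σ[ y ∈ Pt Y ] (U y × (g ∘ y ≈ x))) →
      Σ[ c ∈ Pt F ] ((φ ∘ c ≈ i) × (∀ y → c ∋ y → U y))
    refine {U = U} U-internal i U-over U-total =
        c , φc≈i , λ y c∋y →
          let d , _ , q = r-sub (⊆r (g ∘ y) y c∋y) in holds d q
      where
        open Comprehension₁ (comprehension₁ U-internal)

        r : obj ⇒ X ⊗ Y
        r = ⟨ g ∘ emb , emb ⟩ₚ

        r-sub : ∀ {x y} → ⟨ x , y ⟩ₚ ∈ r →
                Σ[ d ∈ Pt obj ] ((g ∘ (emb ∘ d) ≈ x) × (emb ∘ d ≈ y))
        r-sub (d , eq) = d , ≈-trans (≈-sym assoc) (pair-injˡ eq′) , pair-injʳ eq′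
          where eq′ = ≈-trans (≈-sym pair-∘) eq

        r-isPR : IsPRWithIndex fp f g i r
        r-isPR = record
          { cond-a = λ x y xy∈r →
              let d , p , q = r-sub xy∈r in ≈-trans (∘-congˡ (≈-sym q)) p
          ; cond-b⇒ = λ x fx≈i →
              let y , Uy , gy≈x = U-total x fx≈i
                  d , p = pick Uy
              in y , d , ≈-trans pair-∘
                   (pair-cong (≈-trans assoc (≈-trans (∘-congˡ p) gy≈x)) p)
          ; cond-b⇐ = λ x (y , xy∈r) →
              let d , p , q = r-sub xy∈r
              in ≈-trans (∘-congˡ (≈-sym p)) (U-over (emb ∘ d) (holds d ≈-refl)) }

        c    = proj₁ (full i r r-isPR)
        φc≈i = proj₁ (proj₂ (full i r r-isPR))
        ⊆r   = proj₂ (proj₂ (full i r r-isPR))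

  -- Universal quantification and implication.

  module UniversalQuantifier (closed : ClosedForPseudoRelations fp) where

    -- The image of the index arrow of a full family over f, g consists of the
    -- points whose whole fibre along f lies in the image of g.
    ∀-along : ∀ {Y X I} (f : X ⇒ I) (g : Y ⇒ X) →
      Σ[ F ∈ Obj ] Σ[ φ ∈ F ⇒ I ]
        ((∀ i → (∀ x → f ∘ x ≈ i → x ∈ g) → i ∈ φ) ×
         (∀ i → i ∈ φ → ∀ x → f ∘ x ≈ i → x ∈ g))
    ∀-along f g = F , φ
        , (λ i fibre⊆g →
            -- The predicate is the largest one, all points of `Y` over `i`; its totality is the
            -- inclusion of the fibre in the image of `g`.
            let c , φc≈i , _ = refine (f · g · var₀ ≈ᵢ const i) i (λ _ p → p) λ x fx≈i →
                  let y , gy≈x = fibre⊆g x fx≈i in y , ≈-trans (∘-congˡ gy≈x) fx≈i , gy≈x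
            in c , φc≈i)
        , (λ i (c , φc≈i) x fx≈i →
            let y , _ , gy≈x = total c x (≈-trans fx≈i (≈-sym φc≈i)) in y , gy≈x)
      where open FullFamily (closed g f)

    module _ {Γ : List Obj} where
      infixr 3 _⇒ᵢ_

      -- Quantifies along the projection dropping the first variable: its fibre over a tuple
      -- consists of the extensions of that tuple.
      ∀ᵢ : ∀ {X p} {P : Env (X ∷ Γ) → Set p} → Internal (X ∷ Γ) P →
           Internal Γ (λ ρ → ∀ x → P (x , ρ))
      ∀ᵢ {X} I =
        let F , φ , intro , elim = ∀-along π₂ arr in record
          { dom = F ; arr = φ
          ; to = λ ρ Pρ → intro (encode Γ ρ) λ z eq →
              ∈-resp (≈-trans (pair-cong ≈-refl (≈-sym eq)) pair-η) (to (π₁ ∘ z , ρ) (Pρ _))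
          ; from = λ ρ ρ∈φ x → from (x , ρ) (elim (encode Γ ρ) ρ∈φ _ project₂) }
        where open Internal I

      -- Quantifies along the arrow of the premise, whose fibre over a tuple consists of the
      -- witnesses of `P`; without a witness the condition is vacuous.
      _⇒ᵢ_ : ∀ {p q} {P : Env Γ → Set p} {Q : Env Γ → Set q} →
             Internal Γ P → Internal Γ Q → Internal Γ (λ ρ → P ρ → Q ρ)
      I ⇒ᵢ J =
        let F , φ , intro , elim = ∀-along I.arr p in record
          { dom = F ; arr = φ
          ; to = λ ρ P⇒Q → intro (encode Γ ρ) λ x eq →
              let y , eq′ = J.to ρ (P⇒Q (I.from ρ (x , eq)))
                  w , pw , _ = factor x y (≈-trans eq (≈-sym eq′))
              in w , pw
          ; from = λ ρ ρ∈φ Pρ →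
              let x , eq = I.to ρ Pρ
                  w , pw = elim (encode Γ ρ) ρ∈φ x eq
              in J.from ρ (q ∘ w , ≈-trans (≈-sym assoc) (≈-trans (∘-congʳ (≈-sym commute))
                   (≈-trans assoc (≈-trans (∘-congˡ pw) eq)))) }
        where
          module I = Internal I
          module J = Internal J
          open WeakPullback (weakPullback I.arr J.arr)

-- Objects of the exact completion through their points.

module ExactCompletion {o ℓ e} (C : Category o ℓ e) (fp : FiniteProducts (Category.raw C))
    (weq : HasWeakEqualisers (Category.raw C))
    (choice : ∀ Y → ChoiceObject fp Y)
    (closed : ClosedForPseudoRelations fp) where
  open Category C
  open Points C fp
  open Pr using () renaming (⟨_,_⟩ to ⟨_,_⟩ₚ)
  open ChoiceCategory C fp weq choice
  open UniversalQuantifier closed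
  open ExCompletion C fp using (PseudoEquivalenceRelation; ExHom; ExEq; ExComp; Ex; sq)

  PER : Set (o ⊔ ℓ ⊔ e)
  PER = PseudoEquivalenceRelation

  private module PER = PseudoEquivalenceRelation

  ∣_∣ : PER → Obj
  ∣_∣ = PER.X

  infix 4 _⊢_~_
  -- A record rather than a synonym for membership in an image, so that `A`, `x` and `y` can be
  -- inferred from the type.
  record _⊢_~_ (A : PER) (x y : Pt ∣ A ∣) : Set (ℓ ⊔ e) where
    constructor related
    field witness : ⟨ x , y ⟩ₚ ∈ PER.r A
  open _⊢_~_

  infix 5 _⊢_~ᵢ_
  _⊢_~ᵢ_ : ∀ (A : PER) {Γ k l} → Term Γ ∣ A ∣ k → Term Γ ∣ A ∣ l →
           Internal Γ (λ ρ → A ⊢ k ρ ~ l ρ)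
  A ⊢ k ~ᵢ l = mapᵢ related witness (⟨ k , l ⟩ₜ ∈ᵢ PER.r A)

  module _ {A : PER} where
    open PseudoEquivalenceRelation A
    open IsWeakPullback Q-wpb

    ≈⇒~ : ∀ {x y} → x ≈ y → A ⊢ x ~ y
    ≈⇒~ {x} x≈y = related $ ρ ∘ x ,
      ≈-trans (≈-sym assoc) (≈-trans (∘-congʳ ρ-eq)
        (≈-trans pair-∘ (pair-cong identityˡ (≈-trans identityˡ x≈y))))

    ~-refl : ∀ {x} → A ⊢ x ~ x
    ~-refl = ≈⇒~ ≈-refl

    ~-sym : ∀ {x y} → A ⊢ x ~ y → A ⊢ y ~ x
    ~-sym (related (t , rt)) = related $ σ ∘ t ,
      ≈-trans (≈-sym assoc) (≈-trans (∘-congʳ σ-eq) (≈-trans pair-∘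
        (pair-cong (≈-trans assoc (≈-trans (∘-congˡ rt) project₂))
                   (≈-trans assoc (≈-trans (∘-congˡ rt) project₁)))))

    ~-trans : ∀ {x y z} → A ⊢ x ~ y → A ⊢ y ~ z → A ⊢ x ~ z
    ~-trans (related (t , rt)) (related (t′ , rt′)) =
      let u , q₁u , q₂u = factor t t′
            (≈-trans (≈-trans assoc (≈-trans (∘-congˡ rt) project₂))
              (≈-sym (≈-trans assoc (≈-trans (∘-congˡ rt′) project₁))))
      in related $ τ ∘ u ,
         ≈-trans (≈-sym assoc) (≈-trans (∘-congʳ τ-eq) (≈-trans pair-∘ (pair-cong
           (≈-trans assoc (≈-trans (∘-congˡ q₁u) (≈-trans assoc (≈-trans (∘-congˡ rt) project₁))))
           (≈-trans assoc (≈-trans (∘-congˡ q₂u) (≈-trans assoc (≈-trans (∘-congˡ rt′) project₂)))))))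

  -- Objects from internal equivalence relations.

  module Quotient {X p} (_~_ : Pt X → Pt X → Set p) (~-equiv : IsEquivalence _~_)
      (internal : Internal (X ∷ X ∷ []) (λ (x , y , _) → x ~ y)) where
    open Comprehension₂ (comprehension₂ internal)
    open IsEquivalence ~-equiv using () renaming (refl to reflexive; sym to symmetric; trans to transitive)

    private
      r : obj ⇒ X ⊗ X
      r = ⟨ fst , snd ⟩ₚ

      r₁ r₂ : obj ⇒ X
      r₁ = π₁ ∘ r
      r₂ = π₂ ∘ r

      module Q = WeakPullback (weakPullback r₂ r₁)

      pair∈r : ∀ {x y} → x ~ y → ⟨ x , y ⟩ₚ ∈ r
      pair∈r x~y = let d , p , q = pick x~y in d , ≈-trans pair-∘ (pair-cong p q)

      legs : ∀ (d : Pt obj) → (r₁ ∘ d) ~ (r₂ ∘ d)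
      legs d = holds d (∘-congʳ (≈-sym project₁)) (∘-congʳ (≈-sym project₂))

      -- The arrows `ρ`, `σ` and `τ` all have this shape, so each comes from a pointwise law of
      -- `_~_`.
      lift-pair : ∀ {W} {f g : W ⇒ X} → (∀ (w : Pt W) → (f ∘ w) ~ (g ∘ w)) →
                  Σ[ h ∈ W ⇒ obj ] (r ∘ h ≈ ⟨ f , g ⟩ₚ)
      lift-pair {f = f} {g} f~g =
        lift ⟨ f , g ⟩ₚ r λ w → ∈-resp (≈-sym pair-∘) (pair∈r (f~g w))

      resp : ∀ {x x′ y y′} → x ≈ x′ → y ≈ y′ → x ~ y → x′ ~ y′
      resp p q x~y = let d , p′ , q′ = pick x~y in holds d (≈-trans p′ p) (≈-trans q′ q)

      ρ = lift-pair {f = id} {id} λ x → reflexive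
      σ = lift-pair {f = r₂} {r₁} λ d → symmetric (legs d)
      τ = lift-pair {f = r₁ ∘ Q.p} {r₂ ∘ Q.q} λ d → transitive
        -- The middle point is both `r₂` of the first leg and `r₁` of the second; `Q.commute`
        -- identifies them.
        (resp (≈-sym assoc) (≈-trans (≈-sym assoc) (≈-trans (∘-congʳ Q.commute) assoc))
          (legs (Q.p ∘ d)))
        (resp ≈-refl (≈-sym assoc) (legs (Q.q ∘ d)))

    quotient : PER
    quotient = record
      { X = X ; R = obj ; r = r
      ; ρ = proj₁ ρ ; ρ-eq = proj₂ ρ
      ; σ = proj₁ σ ; σ-eq = proj₂ σ
      ; Q = Q.W ; q₁ = Q.p ; q₂ = Q.q ; Q-wpb = Q.isWeakPullback
      ; τ = proj₁ τ ; τ-eq = proj₂ τ }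

    quotient-intro : ∀ {x y} → x ~ y → quotient ⊢ x ~ y
    quotient-intro x~y = related (pair∈r x~y)

    quotient-elim : ∀ {x y} → quotient ⊢ x ~ y → x ~ y
    quotient-elim (related (d , eq)) = holds d (pair-injˡ eq′) (pair-injʳ eq′)
      where eq′ = ≈-trans (≈-sym pair-∘) eq

  -- Arrows and their equality, pointwise.

  fun : ∀ {A B} → ExHom A B → ∣ A ∣ ⇒ ∣ B ∣
  fun = ExHom.f

  sq-pair : ∀ {W X Y} {f : X ⇒ Y} {x y : W ⇒ X} →
            sq f ∘ ⟨ x , y ⟩ₚ ≈ ⟨ f ∘ x , f ∘ y ⟩ₚ
  sq-pair = ≈-trans pair-∘ (pair-cong (≈-trans assoc (∘-congˡ project₁))
                                      (≈-trans assoc (∘-congˡ project₂)))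

  fun-resp : ∀ {A B} (u : ExHom A B) {x y} → A ⊢ x ~ y → B ⊢ fun u ∘ x ~ fun u ∘ y
  fun-resp u (related (t , rt)) = related $ f̂ ∘ t , ≈-trans (≈-sym assoc) (≈-trans (∘-congʳ f̂-eq)
      (≈-trans assoc (≈-trans (∘-congˡ rt) sq-pair)))
    where open ExHom u

  -- A point of the relation of `A` is a witness for two related points, so compatibility is the
  -- pointwise factorisation from which `lift` makes the tracking arrow.
  hom : ∀ {A B} (f : ∣ A ∣ ⇒ ∣ B ∣) →
        (∀ {x y} → A ⊢ x ~ y → B ⊢ f ∘ x ~ f ∘ y) → ExHom A B
  hom {A} {B} f f-resp = record { f = f ; f̂ = proj₁ f̂ ; f̂-eq = proj₂ f̂ }
    where
      f̂ = lift (sq f ∘ PER.r A) (PER.r B) λ t →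
        ∈-resp (≈-trans (≈-sym sq-pair) (≈-trans (∘-congˡ pair-η) (≈-sym assoc)))
               (witness (f-resp (related (t , ≈-sym pair-η))))

  module _ {A B : PER} where
    ExEq-intro : (u v : ExHom A B) → (∀ x → B ⊢ fun u ∘ x ~ fun v ∘ x) → ExEq u v
    ExEq-intro u v u~v =
      lift ⟨ fun u , fun v ⟩ₚ (PER.r B) λ x → ∈-resp (≈-sym pair-∘) (witness (u~v x))

    ExEq-elim : (u v : ExHom A B) → ExEq u v → ∀ x → B ⊢ fun u ∘ x ~ fun v ∘ x
    ExEq-elim u v (h , rh) x = related $ h ∘ x ,
      ≈-trans (≈-sym assoc) (≈-trans (∘-congʳ rh) pair-∘)

    module _ {D : PER} (a : ExHom D B) (b : ExHom A D) where
      triangle : (c : ExHom A B) → ExEq (ExComp a b) c →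
                 ∀ x → B ⊢ fun a ∘ (fun b ∘ x) ~ fun c ∘ x
      triangle c eq x = ~-trans (≈⇒~ (≈-sym assoc)) (ExEq-elim (ExComp a b) c eq x)

      triangle⁻¹ : (c : ExHom A B) → (∀ x → B ⊢ fun a ∘ (fun b ∘ x) ~ fun c ∘ x) →
                   ExEq (ExComp a b) c
      triangle⁻¹ c eq = ExEq-intro (ExComp a b) c λ x → ~-trans (≈⇒~ assoc) (eq x)

      module _ {D′ : PER} (a′ : ExHom D′ B) (b′ : ExHom A D′) where
        square : ExEq (ExComp a b) (ExComp a′ b′) →
                 ∀ x → B ⊢ fun a ∘ (fun b ∘ x) ~ fun a′ ∘ (fun b′ ∘ x)
        square eq x = ~-trans (triangle (ExComp a′ b′) eq x) (≈⇒~ assoc)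

        square⁻¹ : (∀ x → B ⊢ fun a ∘ (fun b ∘ x) ~ fun a′ ∘ (fun b′ ∘ x)) →
                   ExEq (ExComp a b) (ExComp a′ b′)
        square⁻¹ eq = triangle⁻¹ (ExComp a′ b′) λ x → ~-trans (eq x) (≈⇒~ (≈-sym assoc))

  -- Pullbacks.

  module FibreProduct {X Y A : PER} (f : ExHom X A) (g : ExHom Y A) where
    pairs : Comprehension₂ (λ x y → A ⊢ fun f ∘ x ~ fun g ∘ y)
    pairs = comprehension₂ (A ⊢ fun f · var₀ ~ᵢ fun g · var₁)

    open Comprehension₂ pairs public

    -- Compares coordinates only, so different points of `obj` over one pair become equal; this
    -- makes mediating arrows unique.
    _~_ : Pt obj → Pt obj → Set (ℓ ⊔ e)
    p ~ p′ = (X ⊢ fst ∘ p ~ fst ∘ p′) × (Y ⊢ snd ∘ p ~ snd ∘ p′)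

    abstract
      ~-equiv : IsEquivalence _~_
      ~-equiv = record
        { refl = ~-refl , ~-refl
        ; sym = λ (a , b) → ~-sym a , ~-sym b
        ; trans = λ (a , b) (a′ , b′) → ~-trans a a′ , ~-trans b b′ }

      ~-internal : Internal (obj ∷ obj ∷ []) (λ (p , p′ , _) → p ~ p′)
      ~-internal = (X ⊢ fst · var₀ ~ᵢ fst · var₁) ∧ᵢ (Y ⊢ snd · var₀ ~ᵢ snd · var₁)

    open Quotient _~_ ~-equiv ~-internal public

    proj-X : ExHom quotient X
    proj-X = hom fst λ p → proj₁ (quotient-elim p)

    proj-Y : ExHom quotient Y
    proj-Y = hom snd λ p → proj₂ (quotient-elim p)

    over : ∀ p → A ⊢ fun f ∘ (fst ∘ p) ~ fun g ∘ (snd ∘ p)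
    over p = holds p ≈-refl ≈-refl

    universal : ∀ {W} (a : ExHom W X) (b : ExHom W Y) → ExEq (ExComp f a) (ExComp g b) →
      Σ[ m ∈ ExHom W quotient ] (ExEq (ExComp proj-X m) a × ExEq (ExComp proj-Y m) b)
    universal a b fa~gb =
        m , triangle⁻¹ proj-X m a (λ w → ≈⇒~ (proj₁ (factors w)))
          , triangle⁻¹ proj-Y m b (λ w → ≈⇒~ (proj₂ (factors w)))
      where
        chosen = choose {T = λ w p → (fst ∘ p ≈ fun a ∘ w) × (snd ∘ p ≈ fun b ∘ w)}
          ((fst · var₁ ≈ᵢ fun a · var₀) ∧ᵢ (snd · var₁ ≈ᵢ fun b · var₀))
          (λ w → pick (square f a g b fa~gb w))
        factors = proj₂ chosen
        m = hom (proj₁ chosen) λ {w} {w′} w~w′ → quotient-intro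
          ( ~-trans (≈⇒~ (proj₁ (factors w)))
              (~-trans (fun-resp a w~w′) (≈⇒~ (≈-sym (proj₁ (factors w′)))))
          , ~-trans (≈⇒~ (proj₂ (factors w)))
              (~-trans (fun-resp b w~w′) (≈⇒~ (≈-sym (proj₂ (factors w′))))))

  ex-pullbacks : HasPullbacks Ex
  ex-pullbacks f g = record
    { P = quotient ; p₁ = proj-X ; p₂ = proj-Y
    ; commute = square⁻¹ f proj-X g proj-Y over
    ; universal = universal
    ; unique = λ m m′ eq₁ eq₂ → ExEq-intro m m′ λ w →
        quotient-intro 
          ( square proj-X m proj-X m′ eq₁ w
          , square proj-Y m proj-Y m′ eq₂ w ) }
    where open FibreProduct f g

  -- A point of the exponential over a is a point c of the full family over a
  -- whose pseudo-relation, from the fibre of g to that of h, is functional.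
  module FibreExponential {A Y Z : PER} (g : ExHom Y A) (h : ExHom Z A) where
    domain : Comprehension₂ (λ a y → A ⊢ a ~ fun g ∘ y)
    domain = comprehension₂ (A ⊢ var₀ ~ᵢ fun g · var₁)
    module D = Comprehension₂ domain

    graph : Comprehension₂ (λ d z → A ⊢ D.fst ∘ d ~ fun h ∘ z)
    graph = comprehension₂ (A ⊢ D.fst · var₀ ~ᵢ fun h · var₁)
    module G = Comprehension₂ graph

    -- Through `arg` and `val`, a point of `F` over `a` acts as a total multivalued map from the `y`
    -- with `a ~ g y` to the `z` with `a ~ h z`.
    open FullFamily (closed G.fst D.fst)

    arg : Pt G.obj → Pt ∣ Y ∣
    arg γ = D.snd ∘ (G.fst ∘ γ)

    val : Pt G.obj → Pt ∣ Z ∣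
    val γ = G.snd ∘ γ

    arg-over : ∀ {c γ} → c ∋ γ → A ⊢ φ ∘ c ~ fun g ∘ arg γ
    arg-over {c} {γ} c∋γ = D.holds (G.fst ∘ γ) (index c γ c∋γ) ≈-refl

    val-over : ∀ {c γ} → c ∋ γ → A ⊢ φ ∘ c ~ fun h ∘ val γ
    val-over {c} {γ} c∋γ =
      ~-trans (≈⇒~ (≈-sym (index c γ c∋γ))) (G.holds γ ≈-refl ≈-refl)

    value-at : ∀ c y → A ⊢ φ ∘ c ~ fun g ∘ y → Σ[ γ ∈ Pt G.obj ] ((c ∋ γ) × (arg γ ≈ y))
    value-at c y φc~gy =
      let d , da , dy = D.pick φc~gy
          γ , c∋γ , γd = total c d da
      in γ , c∋γ , ≈-trans (∘-congˡ γd) dy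

    -- `Agree c c` says at once that `c` is single-valued up to `~` and that it respects `~` on
    -- arguments.
    Agree : Pt F → Pt F → Set (ℓ ⊔ e)
    Agree c c′ = ∀ γ γ′ → c ∋ γ → c′ ∋ γ′ → Y ⊢ arg γ ~ arg γ′ → Z ⊢ val γ ~ val γ′

    agree-sym : ∀ {c c′} → Agree c c′ → Agree c′ c
    agree-sym agree γ γ′ c∋γ c∋γ′ y~y′ = ~-sym (agree γ′ γ c∋γ′ c∋γ (~-sym y~y′))

    -- The comparison passes through a value of `c′`, which totality supplies because `c` and `c′`
    -- lie over equivalent points.
    agree-trans : ∀ {c c′ c″} → A ⊢ φ ∘ c ~ φ ∘ c′ → Agree c c′ → Agree c′ c″ → Agree c c″
    agree-trans {c′ = c′} φc~φc′ agree agree′ γ γ″ c∋γ c∋γ″ y~y″ =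
      let γ′ , c∋γ′ , y′≈y = value-at c′ (arg γ) (~-trans (~-sym φc~φc′) (arg-over c∋γ))
      in ~-trans (agree γ γ′ c∋γ c∋γ′ (≈⇒~ (≈-sym y′≈y)))
                 (agree′ γ′ γ″ c∋γ′ c∋γ″ (~-trans (≈⇒~ y′≈y) y~y″))

    abstract
      agreeᵢ : ∀ {Γ k l} → Term Γ F k → Term Γ F l → Internal Γ (λ ρ → Agree (k ρ) (l ρ))
      agreeᵢ k l = ∀ᵢ (∀ᵢ (wk (wk k) ∋ᵢ var₁ ⇒ᵢ wk (wk l) ∋ᵢ var₀ ⇒ᵢ
        Y ⊢ D.snd · G.fst · var₁ ~ᵢ D.snd · G.fst · var₀ ⇒ᵢ
        Z ⊢ G.snd · var₁ ~ᵢ G.snd · var₀))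

    functional : Comprehension₁ (λ c → Agree c c)
    functional = comprehension₁ (agreeᵢ var₀ var₀)
    open Comprehension₁ functional

    _~_ : Pt obj → Pt obj → Set (ℓ ⊔ e)
    t ~ t′ = (A ⊢ φ ∘ (emb ∘ t) ~ φ ∘ (emb ∘ t′)) × Agree (emb ∘ t) (emb ∘ t′)

    abstract
      ~-equiv : IsEquivalence _~_
      ~-equiv = record
        { refl = λ {t} → ~-refl , holds t ≈-refl
        ; sym = λ (a , agree) → ~-sym a , agree-sym agree
        ; trans = λ (a , agree) (a′ , agree′) → ~-trans a a′ , agree-trans a agree agree′ }

      ~-internal : Internal (obj ∷ obj ∷ []) (λ (t , t′ , _) → t ~ t′)
      ~-internal = (A ⊢ φ · emb · var₀ ~ᵢ φ · emb · var₁) ∧ᵢ agreeᵢ (emb · var₀) (emb · var₁)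

    open Quotient _~_ ~-equiv ~-internal

    exponential : PER
    exponential = quotient

    structure : ExHom exponential A
    structure = hom (φ ∘ emb) λ t~t′ →
      ~-trans (≈⇒~ assoc) (~-trans (proj₁ (quotient-elim t~t′)) (≈⇒~ (≈-sym assoc)))

    module E×Y = FibreProduct structure g

    IsValue : Pt E×Y.obj → Pt G.obj → Set (ℓ ⊔ e)
    IsValue p γ = (emb ∘ (E×Y.fst ∘ p) ∋ γ) × (arg γ ≈ E×Y.snd ∘ p)

    abstract
      -- Any value may be chosen; functionality makes the choice immaterial up to `~`.
      value : Σ[ k ∈ E×Y.obj ⇒ G.obj ] (∀ p → IsValue p (k ∘ p))
      value = choose {T = IsValue}
        ((emb · E×Y.fst · var₀ ∋ᵢ var₁) ∧ᵢ (D.snd · G.fst · var₁ ≈ᵢ E×Y.snd · var₀))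
        (λ p → value-at _ _ (~-trans (≈⇒~ (≈-sym assoc)) (E×Y.over p)))

    eval : Pt E×Y.obj → Pt ∣ Z ∣
    eval p = val (proj₁ value ∘ p)

    -- Equivalence of the two indices includes their agreement, applied here to the chosen value and
    -- `γ`. Compatibility of `ev`, `β` and `η` rest on this.
    eval-unique : ∀ p {t γ} → exponential ⊢ E×Y.fst ∘ p ~ t → emb ∘ t ∋ γ →
                  Y ⊢ E×Y.snd ∘ p ~ arg γ → Z ⊢ eval p ~ val γ
    eval-unique p p~t t∋γ y~ =
      let p∋ , arg≈ = proj₂ value p
      in proj₂ (quotient-elim p~t) _ _ p∋ t∋γ (~-trans (≈⇒~ arg≈) y~)

    ev : ExHom E×Y.quotient Z
    ev = hom (G.snd ∘ proj₁ value) λ {p} {p′} p~p′ →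
      let t~t′ , y~y′ = E×Y.quotient-elim p~p′
          p′∋ , arg≈ = proj₂ value p′
      in ~-trans (≈⇒~ assoc) (~-trans
           (eval-unique p t~t′ p′∋ (~-trans y~y′ (≈⇒~ (≈-sym arg≈))))
           (≈⇒~ (≈-sym assoc)))

    ev-over : ∀ p → A ⊢ fun h ∘ (fun ev ∘ p) ~ fun structure ∘ (E×Y.fst ∘ p)
    ev-over p = ~-trans (≈⇒~ (∘-congˡ assoc))
      (~-trans (~-sym (val-over (proj₁ (proj₂ value p)))) (≈⇒~ (≈-sym assoc)))

    -- Currying.

    module Currying {W : PER} (w : ExHom W A)
        (u : ExHom (FibreProduct.quotient w g) Z)
        (u-over : ExEq (ExComp h u) (ExComp w (FibreProduct.proj-X w g))) where
      module W×Y = FibreProduct w g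

      over-W : ∀ p → A ⊢ fun h ∘ (fun u ∘ p) ~ fun w ∘ (W×Y.fst ∘ p)
      over-W = square h u w W×Y.proj-X u-over

      -- Expresses `z ~ u(v,y)` through all pairs `p` representing `(v,y)` up to `~`, so no
      -- representative has to be chosen.
      Bounded : Pt ∣ W ∣ → Pt G.obj → Set (ℓ ⊔ e)
      Bounded v γ = ∀ p → W ⊢ W×Y.fst ∘ p ~ v → Y ⊢ W×Y.snd ∘ p ~ arg γ →
                    Z ⊢ fun u ∘ p ~ val γ

      OverBounded : Pt ∣ W ∣ → Pt G.obj → Set (ℓ ⊔ e)
      OverBounded v γ = (D.fst ∘ (G.fst ∘ γ) ≈ fun w ∘ v) × Bounded v γ

      -- `t` stands for `u(v,-)`. Containment suffices: by `bounded-agree` any two names of `v` are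
      -- equivalent.
      Names : Pt ∣ W ∣ → Pt obj → Set (ℓ ⊔ e)
      Names v t = (φ ∘ (emb ∘ t) ≈ fun w ∘ v) × (∀ γ → emb ∘ t ∋ γ → Bounded v γ)

      abstract
        boundedᵢ : ∀ {Γ k l} → Term Γ ∣ W ∣ k → Term Γ G.obj l →
                   Internal Γ (λ ρ → Bounded (k ρ) (l ρ))
        boundedᵢ k l = ∀ᵢ (W ⊢ W×Y.fst · var₀ ~ᵢ wk k ⇒ᵢ
          Y ⊢ W×Y.snd · var₀ ~ᵢ D.snd · G.fst · wk l ⇒ᵢ
          Z ⊢ fun u · var₀ ~ᵢ G.snd · wk l)

        namesᵢ : Internal (∣ W ∣ ∷ obj ∷ []) (λ (v , t , _) → Names v t)
        namesᵢ = (φ · emb · var₁ ≈ᵢ fun w · var₀) ∧ᵢ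
          ∀ᵢ (emb · var₂ ∋ᵢ var₀ ⇒ᵢ boundedᵢ var₁ var₀)

        -- The value at `d` is `u` of a pair representing `v` and the argument in `d`; other
        -- representatives give equivalent values since `u` respects `~`.
        bounded-total : ∀ v d → D.fst ∘ d ≈ fun w ∘ v →
          Σ[ γ ∈ Pt G.obj ] (OverBounded v γ × (G.fst ∘ γ ≈ d))
        bounded-total v d da≈wv =
          let p , p-v , p-y = W×Y.pick (D.holds d da≈wv ≈-refl)
              γ , γd , γz = G.pick (~-trans (≈⇒~ (≈-trans da≈wv (∘-congˡ (≈-sym p-v))))
                                           (~-sym (over-W p)))
          in γ , (≈-trans (∘-congˡ γd) da≈wv , λ p′ p′~v p′~y →
                   ~-trans (fun-resp u (W×Y.quotient-intro
                     ( ~-trans p′~v (≈⇒~ (≈-sym p-v))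
                     , ~-trans p′~y (≈⇒~ (≈-trans (∘-congˡ γd) (≈-sym p-y))))))
                   (≈⇒~ (≈-sym γz))) , γd

        -- Both values are equivalent to `u` at one pair `p`. This yields functionality of the
        -- names, compatibility of `curry`, and uniqueness.
        bounded-agree : ∀ v {c c′} → A ⊢ φ ∘ c ~ fun w ∘ v →
          (∀ γ → c ∋ γ → Bounded v γ) → (∀ γ → c′ ∋ γ → Bounded v γ) → Agree c c′
        bounded-agree v φc~wv bound bound′ γ γ′ c∋γ c′∋γ′ y~y′ =
          let p , p-v , p-y = W×Y.pick (~-trans (~-sym φc~wv) (arg-over c∋γ))
          in ~-trans (~-sym (bound γ c∋γ p (≈⇒~ p-v) (≈⇒~ p-y)))
                     (bound′ γ′ c′∋γ′ p (≈⇒~ p-v) (~-trans (≈⇒~ p-y) y~y′))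

        bounded-family : ∀ v →
          Σ[ c ∈ Pt F ] ((φ ∘ c ≈ fun w ∘ v) × (∀ γ → c ∋ γ → OverBounded v γ))
        bounded-family v = refine {U = OverBounded v}
          ((D.fst · G.fst · var₀ ≈ᵢ const (fun w ∘ v)) ∧ᵢ boundedᵢ (const v) var₀)
          (fun w ∘ v) (λ _ → proj₁) (bounded-total v)

        named : ∀ v → Σ[ t ∈ Pt obj ] Names v t
        named v = t , ≈-trans (∘-congˡ t≈c) φc≈wv , λ γ t∋γ →
            bounded γ (∈-resp (pair-cong t≈c ≈-refl) t∋γ)
          where
            c : Pt F
            c = proj₁ (bounded-family v)

            φc≈wv : φ ∘ c ≈ fun w ∘ v
            φc≈wv = proj₁ (proj₂ (bounded-family v))

            bounded : ∀ γ → c ∋ γ → Bounded v γ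
            bounded γ c∋γ = proj₂ (proj₂ (proj₂ (bounded-family v)) γ c∋γ)

            c∈emb : c ∈ emb
            c∈emb = pick (bounded-agree v (≈⇒~ φc≈wv) bounded bounded)

            t : Pt obj
            t = proj₁ c∈emb

            t≈c : emb ∘ t ≈ c
            t≈c = proj₂ c∈emb

        name : Σ[ f ∈ ∣ W ∣ ⇒ obj ] (∀ v → Names v (f ∘ v))
        name = choose namesᵢ named

      bounded-resp : ∀ {v v′} γ → W ⊢ v ~ v′ → Bounded v γ → Bounded v′ γ
      bounded-resp γ v~v′ bound p p~v′ = bound p (~-trans p~v′ (~-sym v~v′))

      curry : ExHom W exponential
      curry = hom (proj₁ name) λ {v} {v′} v~v′ →
        let φ≈ , bound = proj₂ name v
            φ≈′ , bound′ = proj₂ name v′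
        in quotient-intro
             ( ~-trans (≈⇒~ φ≈) (~-trans (fun-resp w v~v′) (≈⇒~ (≈-sym φ≈′)))
             -- The first bound is carried from `v` to `v′`, so that both names are bounded at the
             -- same point.
             , bounded-agree v′ (~-trans (≈⇒~ φ≈) (fun-resp w v~v′))
                 (λ γ t∋γ → bounded-resp γ v~v′ (bound γ t∋γ)) bound′ )

      curry-over : ∀ v → A ⊢ fun structure ∘ (fun curry ∘ v) ~ fun w ∘ v
      curry-over v = ~-trans (≈⇒~ assoc) (≈⇒~ (proj₁ (proj₂ name v)))

      -- The name of `v` has a value `γ` at the second coordinate of `p`; evaluation agrees with it
      -- by `eval-unique`, and boundedness makes it equivalent to `u` at `p`.
      β : (m : ExHom W×Y.quotient E×Y.quotient) →
          (∀ p → exponential ⊢ E×Y.fst ∘ (fun m ∘ p) ~ fun curry ∘ (W×Y.fst ∘ p)) →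
          (∀ p → Y ⊢ E×Y.snd ∘ (fun m ∘ p) ~ W×Y.snd ∘ p) →
          ∀ p → Z ⊢ fun ev ∘ (fun m ∘ p) ~ fun u ∘ p
      β m m₁ m₂ p = ~-trans (≈⇒~ assoc) (~-trans
          (eval-unique (fun m ∘ p) {t} {γ} (m₁ p) t∋γ (~-trans (m₂ p) (~-sym y~)))
          (~-sym (proj₂ (proj₂ name v) γ t∋γ p ~-refl (~-sym y~))))
        where
          v : Pt ∣ W ∣
          v = W×Y.fst ∘ p

          t : Pt obj
          t = fun curry ∘ v

          at-p : Σ[ γ ∈ Pt G.obj ] ((emb ∘ t ∋ γ) × (arg γ ≈ W×Y.snd ∘ p))
          at-p = value-at (emb ∘ t) (W×Y.snd ∘ p)
            (~-trans (≈⇒~ (proj₁ (proj₂ name v))) (W×Y.over p))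

          γ : Pt G.obj
          γ = proj₁ at-p

          t∋γ : emb ∘ t ∋ γ
          t∋γ = proj₁ (proj₂ at-p)

          y~ : Y ⊢ arg γ ~ W×Y.snd ∘ p
          y~ = ≈⇒~ (proj₂ (proj₂ at-p))

      -- By `eval-unique` the values of `t` at `v` are equivalent to those of `ev` after `m`, hence
      -- to those of `u`; so `t` is bounded like `curry`, and `bounded-agree` applies.
      η : (t : ExHom W exponential) → (∀ v → A ⊢ fun structure ∘ (fun t ∘ v) ~ fun w ∘ v) →
          (m : ExHom W×Y.quotient E×Y.quotient) →
          (∀ p → exponential ⊢ E×Y.fst ∘ (fun m ∘ p) ~ fun t ∘ (W×Y.fst ∘ p)) →
          (∀ p → Y ⊢ E×Y.snd ∘ (fun m ∘ p) ~ W×Y.snd ∘ p) →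
          (∀ p → Z ⊢ fun ev ∘ (fun m ∘ p) ~ fun u ∘ p) →
          ∀ v → exponential ⊢ fun t ∘ v ~ fun curry ∘ v
      η t t-over m m₁ m₂ ev-m v = quotient-intro
          ( ~-trans φt~wv (≈⇒~ (≈-sym (proj₁ (proj₂ name v))))
          , bounded-agree v φt~wv bound (proj₂ (proj₂ name v)) )
        where
          φt~wv : A ⊢ φ ∘ (emb ∘ (fun t ∘ v)) ~ fun w ∘ v
          φt~wv = ~-trans (≈⇒~ (≈-sym assoc)) (t-over v)

          bound : ∀ γ → emb ∘ (fun t ∘ v) ∋ γ → Bounded v γ
          bound γ t∋γ p p~v p~y = ~-trans (~-sym (ev-m p)) (~-trans (≈⇒~ assoc)
            (eval-unique (fun m ∘ p) {fun t ∘ v} {γ} (~-trans (m₁ p) (fun-resp t p~v)) t∋γ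
              (~-trans (m₂ p) p~y)))

      -- The laws of currying as equations of arrows.

      ex-curry-over : ExEq (ExComp structure curry) w
      ex-curry-over = triangle⁻¹ structure curry w curry-over

      -- Characterises `m` as the product of `t` with `Y` over `A`.
      Extends : ExHom W exponential → ExHom W×Y.quotient E×Y.quotient → Set (ℓ ⊔ e)
      Extends t m = ExEq (ExComp E×Y.proj-X m) (ExComp t W×Y.proj-X)
                  × ExEq (ExComp E×Y.proj-Y m) W×Y.proj-Y

      ex-β : ∀ m → Extends curry m → ExEq (ExComp ev m) u
      ex-β m (m₁ , m₂) = triangle⁻¹ ev m u
        (β m (square E×Y.proj-X m curry W×Y.proj-X m₁) (triangle E×Y.proj-Y m W×Y.proj-Y m₂))

      -- The last hypothesis of `ex-η` speaks of every `m` extending `t`; one must be exhibited for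
      -- it to yield an equation.
      extension : ∀ t → ExEq (ExComp structure t) w → Σ[ m ∈ _ ] Extends t m
      extension t t-over = E×Y.universal (ExComp t W×Y.proj-X) W×Y.proj-Y
        (square⁻¹ structure (ExComp t W×Y.proj-X) g W×Y.proj-Y λ p →
          ~-trans (≈⇒~ (∘-congˡ assoc))
            (~-trans (triangle structure t w t-over (W×Y.fst ∘ p)) (W×Y.over p)))

      ex-η : ∀ t → ExEq (ExComp structure t) w →
             (∀ m → Extends t m → ExEq (ExComp ev m) u) → ExEq t curry
      ex-η t t-over ev-m = ExEq-intro t curry (η t (triangle structure t w t-over) m
          (square E×Y.proj-X m t W×Y.proj-X m₁) (triangle E×Y.proj-Y m W×Y.proj-Y m₂)
          (triangle ev m u (ev-m m (m₁ , m₂))))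
        where
          m : ExHom W×Y.quotient E×Y.quotient
          m = proj₁ (extension t t-over)
          m₁ : ExEq (ExComp E×Y.proj-X m) (ExComp t W×Y.proj-X)
          m₁ = proj₁ (proj₂ (extension t t-over))
          m₂ : ExEq (ExComp E×Y.proj-Y m) W×Y.proj-Y
          m₂ = proj₂ (proj₂ (extension t t-over))

  ex-exponentials : ∀ {A Y Z} (g : ExHom Y A) (h : ExHom Z A) →
                    SliceExponential Ex ex-pullbacks g h
  ex-exponentials {A} {Y} {Z} g h = record
    { E = exponential
    ; e↓ = structure
    ; ev = ev
    ; ev-over = square⁻¹ h ev structure E×Y.proj-X ev-over
    ; curry = Currying.curry
    ; curry-over = Currying.ex-curry-over
    ; β = λ w u u-over m m₁ m₂ → Currying.ex-β w u u-over m (m₁ , m₂)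
    ; η = λ w u u-over t t-over ev-m →
        Currying.ex-η w u u-over t t-over λ m (m₁ , m₂) → ev-m m m₁ m₂ }
    where open FibreExponential g h

theorem4p9 : ∀ {o ℓ e} (C : Category o ℓ e)
    (fp : FiniteProducts (Category.raw C)) →
    HasWeakEqualisers (Category.raw C) →
    (∀ (Y : Category.Obj C) → ChoiceObject fp Y) →
    ClosedForPseudoRelations fp →
    IsLCC (ExCompletion.Ex C fp)
theorem4p9 C fp weq choice closed = ex-pullbacks , ex-exponentials
  where open ExactCompletion C fp weq choice closed
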